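{- Let $\lambda$ be an indecomposable permutation of length $\ell>1$, and let $1\le m\le n$ be integers, so that $[\lambda^m,\lambda^n]$ is an interval of the permutation pattern poset. Then $$\mathrm{EZ}(\lambda^m,\lambda^n)=(-1)^{n-m-1}\binom{n-1}{m-1}.$$
   Context: A permutation of length $n\ge 1$ is written in one-line notation $\pi=\pi_1\cdots\pi_n$, and $|\pi|=n$. An occurrence of $\sigma$ in $\pi$ is a subsequence of $\pi$ (a choice of positions) whose letters are in the same relative order of size as the letters of $\sigma$; the permutation pattern poset has $\sigma\le\pi$ iff there is an occurrence of $\sigma$ in $\pi$. The direct sum $\sigma\oplus\pi$ is obtained by appending $\pi$ to $\sigma$ after adding $|\sigma|$ to each letter of $\pi$. A permutation is decomposable if it is the direct sum of two or more non-empty permutations, and indecomposable otherwise. For an indecomposable $\lambda$, $\lambda^n:=\lambda\oplus\cdots\oplus\lambda$ ($n$ copies). An adjacency in a permutation $\pi$ is a maximal sequence (of length $\ge 1$) of letters in consecutive positions that have consecutive values and are increasing or decreasing. The adjacencies partition the positions of $\pi$. An embedding $\eta$ of $\sigma$ in $\pi$ is a sequence of length $|\pi|$ whose nonzero letters are the letters of an occurrence of $\sigma$ in $\pi$, in the same positions as in $\pi$, all other entries being $0$. Two embeddings of $\sigma$ in $\pi$ are equivalent if they differ only within adjacencies of $\pi$, i.e. for every adjacency of $\pi$ they have the same number of nonzero entries among the positions of that adjacency. $\widehat{E}^{\sigma,\pi}$ is the set consisting of the rightmost embedding of each equivalence class, i.e. the one whose nonzero entries within each adjacency occupy the last positions of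 that adjacency. For $\eta\in\widehat{E}^{\sigma,\pi}$ let $Z(\eta)=\{i:\eta_i=0\}$. $\mathrm{EZ}^{\sigma,\pi}$ is the set of all nonempty subsets $S\subseteq\widehat{E}^{\sigma,\pi}$ with $\bigcap_{\eta\in S}Z(\eta)=\emptyset$, and $\mathrm{EZ}(\sigma,\pi):=\sum_{S\in\mathrm{EZ}^{\sigma,\pi}}(-1)^{|S|}$. -}

module Defs where

open import Data.Bool.Base using (if_then_else_)
open import Data.Fin.Base as Fin using (Fin; toℕ; cast)
open import Data.Fin.Permutation using (Permutation′; _⟨$⟩ʳ_; _≈_; id)
open import Data.Fin.Properties as Fin using (+↔⊎; all?)
open import Data.Fin.Subset using (Subset; inside; outside; ⋂; Empty)
open import Data.Fin.Subset.Properties using (_∈?_; nonempty?)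
open import Data.Integer.Base as ℤ using (ℤ; 0ℤ; -1ℤ)
open import Data.List.Base as List using (List; []; _∷_; _++_; length; allFin; filter; foldr)
open import Data.Nat.Base using (ℕ; zero; suc; _+_; _*_; _≤_; _<_; NonZero)
open import Data.Nat.Properties using (_≟_; _<?_)
open import Data.Product.Base using (Σ; ∃-syntax; _×_; _,_)
open import Data.Sum.Base using (_⊎_)
open import Data.Sum.Function.Propositional using (_⊎-↔_)
open import Data.Vec.Base as Vec using (Vec)
open import Function.Bundles using (_⇔_; mk⇔; Equivalence)
open import Function.Construct.Composition using (_↔-∘_)
open import Function.Construct.Symmetry using (↔-sym)
open import Relation.Binary.PropositionalEquality.Core using (_≡_; _≢_)
open import Relation.Nullary using (¬_; Dec; yes; no; does)
open import Relation.Nullary.Decidable using (map′; ¬?; _×-dec_; _⊎-dec_; _→-dec_)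

private
  variable
    j k n r : ℕ
    A : Set

-- A permutation of length n is a `Permutation′ n` (its letters are 0, …, n-1).
-- `letter` shifts these to the one-line letters 1, …, n, so that 0 is free to
-- serve as the filler in embeddings.
letter : Permutation′ n → Fin n → ℕ
letter π i = suc (toℕ (π ⟨$⟩ʳ i))

word : Permutation′ n → List ℕ
word {n} π = List.map (letter π) (allFin n)

------------------------------------------------------------------------
-- Direct sums

infixr 7 _⊕_

-- Under Fin (j + k) ↔ Fin j ⊎ Fin k, the right summand is the last k
-- positions on the source side and the k largest letters on the target side.
_⊕_ : Permutation′ j → Permutation′ k → Permutation′ (j + k)
σ ⊕ τ = ↔-sym +↔⊎ ↔-∘ ((σ ⊎-↔ τ) ↔-∘ +↔⊎)

-- `IsSum r π`: π is the direct sum of r non-empty permutations (r ≥ 1).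
data IsSum : ℕ → Permutation′ n → Set where
  single : {π : Permutation′ n} → NonZero n → IsSum 1 π
  cons   : {σ : Permutation′ j} {τ : Permutation′ k} {π : Permutation′ (j + k)} →
           NonZero j → IsSum r τ → π ≈ σ ⊕ τ → IsSum (suc r) π

Decomposable : Permutation′ n → Set
Decomposable π = ∃[ r ] 2 ≤ r × IsSum r π

Indecomposable : Permutation′ n → Set
Indecomposable π = ¬ Decomposable π

infixr 8 _^⊕_

_^⊕_ : Permutation′ k → (n : ℕ) → Permutation′ (n * k)
π ^⊕ zero  = id
π ^⊕ suc n = π ⊕ (π ^⊕ n)

------------------------------------------------------------------------
-- Occurrences and embeddings

SameOrder : List ℕ → List ℕ → Set
SameOrder xs ys = Σ (length xs ≡ length ys) λ e → ∀ i j →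
  (List.lookup xs i < List.lookup xs j) ⇔
  (List.lookup ys (cast e i) < List.lookup ys (cast e j))

private
  _⇔-dec_ : {P Q : Set} → Dec P → Dec Q → Dec (P ⇔ Q)
  p? ⇔-dec q? =
    map′ (λ (f , g) → mk⇔ f g) (λ e → Equivalence.to e , Equivalence.from e)
         ((p? →-dec q?) ×-dec (q? →-dec p?))

sameOrder? : ∀ xs ys → Dec (SameOrder xs ys)
sameOrder? xs ys with length xs ≟ length ys
... | no  ne = no λ (e , _) → ne e
... | yes e  = map′ (e ,_) (λ (_ , f) → f)
  (all? λ i → all? λ j →
    (List.lookup xs i <? List.lookup xs j) ⇔-dec
    (List.lookup ys (cast e i) <? List.lookup ys (cast e j)))

-- The letters of π at the chosen positions, read from left to right.
lettersAt : Permutation′ n → Subset n → List ℕ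
lettersAt {n} π p = List.map (letter π) (filter (_∈? p) (allFin n))

IsOccurrence : Permutation′ k → Permutation′ n → Subset n → Set
IsOccurrence σ π p = SameOrder (lettersAt π p) (word σ)

isOccurrence? : (σ : Permutation′ k) (π : Permutation′ n) (p : Subset n) →
                Dec (IsOccurrence σ π p)
isOccurrence? σ π p = sameOrder? (lettersAt π p) (word σ)

embed : Permutation′ n → Subset n → Vec ℕ n
embed π p = Vec.tabulate λ i → if does (i ∈? p) then letter π i else 0

subsets : ∀ n → List (Subset n)
subsets zero    = Vec.[] ∷ []
subsets (suc n) = List.map (inside Vec.∷_) (subsets n) ++ List.map (outside Vec.∷_) (subsets n)

-- Distinct occurrences give distinct embeddings because letters are nonzero,
-- so this list has no repetitions.
embeddings : Permutation′ k → Permutation′ n → List (Vec ℕ n)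
embeddings {n = n} σ π = List.map (embed π) (filter (isOccurrence? σ π) (subsets n))

------------------------------------------------------------------------
-- Adjacencies; a segment of positions is given by its first position i and
-- its last position j.

Increasing : Permutation′ n → Fin n → Fin n → Set
Increasing π i j = ∀ p q → i Fin.≤ p → q Fin.≤ j → toℕ q ≡ suc (toℕ p) →
                   letter π q ≡ suc (letter π p)

Decreasing : Permutation′ n → Fin n → Fin n → Set
Decreasing π i j = ∀ p q → i Fin.≤ p → q Fin.≤ j → toℕ q ≡ suc (toℕ p) →
                   letter π p ≡ suc (letter π q)

Run : Permutation′ n → Fin n → Fin n → Set
Run π i j = Increasing π i j ⊎ Decreasing π i j

Adjacency : Permutation′ n → Fin n → Fin n → Set
Adjacency π i j = i Fin.≤ j × Run π i j ×
  (∀ i′ j′ → i′ Fin.≤ i → j Fin.≤ j′ → Run π i′ j′ → i′ ≡ i × j′ ≡ j)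

-- The equivalence class of an embedding of σ in π is determined by its number
-- of nonzero entries in each adjacency of π; its rightmost element is the one
-- whose nonzero entries within each adjacency come last.
Rightmost : Permutation′ n → Vec ℕ n → Set
Rightmost π η = ∀ i j → Adjacency π i j →
  ∀ p q → i Fin.≤ p → p Fin.< q → q Fin.≤ j →
  Vec.lookup η p ≢ 0 → Vec.lookup η q ≢ 0

increasing? : (π : Permutation′ n) → ∀ i j → Dec (Increasing π i j)
increasing? π i j = all? λ p → all? λ q →
  (i Fin.≤? p) →-dec (q Fin.≤? j) →-dec (toℕ q ≟ suc (toℕ p)) →-dec
  (letter π q ≟ suc (letter π p))

decreasing? : (π : Permutation′ n) → ∀ i j → Dec (Decreasing π i j)
decreasing? π i j = all? λ p → all? λ q →
  (i Fin.≤? p) →-dec (q Fin.≤? j) →-dec (toℕ q ≟ suc (toℕ p)) →-dec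
  (letter π p ≟ suc (letter π q))

run? : (π : Permutation′ n) → ∀ i j → Dec (Run π i j)
run? π i j = increasing? π i j ⊎-dec decreasing? π i j

adjacency? : (π : Permutation′ n) → ∀ i j → Dec (Adjacency π i j)
adjacency? π i j = (i Fin.≤? j) ×-dec run? π i j ×-dec
  (all? λ i′ → all? λ j′ →
    (i′ Fin.≤? i) →-dec (j Fin.≤? j′) →-dec run? π i′ j′ →-dec
    ((i′ Fin.≟ i) ×-dec (j′ Fin.≟ j)))

rightmost? : (π : Permutation′ n) → ∀ η → Dec (Rightmost π η)
rightmost? π η = all? λ i → all? λ j → adjacency? π i j →-dec
  (all? λ p → all? λ q →
    (i Fin.≤? p) →-dec (p Fin.<? q) →-dec (q Fin.≤? j) →-dec
    ¬? (Vec.lookup η p ≟ 0) →-dec ¬? (Vec.lookup η q ≟ 0))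

Ê : Permutation′ k → Permutation′ n → List (Vec ℕ n)
Ê σ π = filter (rightmost? π) (embeddings σ π)

------------------------------------------------------------------------
-- EZ

Z : Vec ℕ n → Subset n
Z = Vec.map λ x → does (x ≟ 0)

-- Each sublist of a list once; for a repetition-free list these are exactly
-- the subsets of its set of elements.
sublists : List A → List (List A)
sublists []       = [] ∷ []
sublists (x ∷ xs) = List.map (x ∷_) (sublists xs) ++ sublists xs

IsEZ : List (Vec ℕ n) → Set
IsEZ S = S ≢ [] × Empty (⋂ (List.map Z S))

isEZ? : (S : List (Vec ℕ n)) → Dec (IsEZ S)
isEZ? S = nonnil? S ×-dec ¬? (nonempty? (⋂ (List.map Z S)))
  where
  nonnil? : (xs : List A) → Dec (xs ≢ [])
  nonnil? []       = no λ ne → ne _≡_.refl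
  nonnil? (_ ∷ _) = yes λ ()

EZsets : Permutation′ k → Permutation′ n → List (List (Vec ℕ n))
EZsets σ π = filter isEZ? (sublists (Ê σ π))

EZ : Permutation′ k → Permutation′ n → ℤ
EZ σ π = foldr ℤ._+_ 0ℤ (List.map (λ S → -1ℤ ℤ.^ length S) (EZsets σ π))

-- (-1)^z for an integer exponent z; (-1)^(-k) = (-1)^k.
infix 9 -1^_

-1^_ : ℤ → ℤ
-1^ z = -1ℤ ℤ.^ ℤ.∣ z ∣

module Submission where

-- Every occurrence of ƛ^m in ƛ^n is a union of m of the n copies of ƛ: since ƛ is indecomposable, a
-- nonempty proper part of a copy cannot match the beginning of ƛ^m. Adjacencies of ƛ^n do not cross
-- copies either, so each such occurrence is automatically rightmost.
--
-- Since Σ_{T ⊆ P} (-1)^|T| is 1 for P = ∅ and 0 otherwise, exchanging sums turns EZ into the sum of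
-- (-1)^|T| over the sets T of positions that lie in no Z(η). For ƛ^m and ƛ^n these are the T that
-- leave fewer than m copies untouched. Splitting off the first copy, the sum F(n, m) satisfies
-- F(n+1, m+1) = F(n, m) - F(n, m+1), because the nonempty subsets of a copy have total sign -1.

open import Defs
open import Data.Bool.Base using (Bool; true; false; if_then_else_)
open import Data.Fin.Base as Fin using (Fin; zero; suc; toℕ; cast; _↑ˡ_; _↑ʳ_; splitAt; fromℕ<; opposite)
open import Data.Fin.Permutation using (Permutation′; permutation; _⟨$⟩ʳ_; _⟨$⟩ˡ_; inverseˡ; inverseʳ)
import Data.Fin.Properties as Fin
open import Data.Fin.Subset using (Subset; inside; outside; ⊤; ⊥; _∈_; _∉_; _⊆_; _∩_; ⋂; ∣_∣; Empty; Nonempty)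
open import Data.Fin.Subset.Properties
open import Data.Integer using (ℤ; +_; -_; _+_; _-_; _*_; _^_; 0ℤ; 1ℤ; -1ℤ)
import Data.Integer.Properties as ℤ
open import Data.Integer.Tactic.RingSolver using (solve-∀)
open import Data.List.Base as List using (List; []; _∷_; _++_; foldr; filter; length; allFin)
import Data.List.Properties as List
open import Data.List.Membership.Propositional using () renaming (_∈_ to _∈ˡ_)
open import Data.List.Membership.Propositional.Properties
  using (∈-map⁺; ∈-map⁻; ∈-++⁺ˡ; ∈-++⁺ʳ; ∈-filter⁺; ∈-filter⁻)
open import Data.List.Relation.Unary.Any using (here; there)
open import Data.Nat as ℕ using (ℕ; zero; suc; _≤_; _<_; z≤n; s≤s; _∸_)
open import Data.Nat.Combinatorics using (_C_; nCk+nC[k+1]≡[n+1]C[k+1])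
import Data.Nat.Properties as ℕ
open import Data.Product.Base using (_×_; _,_; proj₁; proj₂; ∃; ∃₂; Σ)
open import Data.Sum.Base as Sum using (_⊎_; inj₁; inj₂)
open import Data.Vec.Base as Vec using (Vec; []; _∷_)
import Data.Vec.Properties as Vec
open import Function.Base using (_∘_; id)
open import Function.Bundles using (_⇔_; mk⇔; Equivalence)
open import Relation.Binary.PropositionalEquality
open import Relation.Nullary using (¬_; Dec; yes; no; does; contradiction)
open import Relation.Nullary.Decidable using (does-⇔; dec-true; dec-false; decidable-stable; ¬?)
open import Relation.Unary using (Pred; Decidable)

private
  variable
    A B : Set
    P Q : Set
    j k m n N : ℕ
    x x′ y y′ : A
    xs ys us vs : List A

-- Alternating sums over subsets

∑ : List A → (A → ℤ) → ℤ
∑ xs f = foldr _+_ 0ℤ (List.map f xs)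

∑-++ : ∀ (xs ys : List A) f → ∑ (xs ++ ys) f ≡ ∑ xs f + ∑ ys f
∑-++ []       ys f = sym (ℤ.+-identityˡ _)
∑-++ (x ∷ xs) ys f = trans (cong (λ i → f x + i) (∑-++ xs ys f)) (sym (ℤ.+-assoc (f x) _ _))

∑-map : ∀ (g : A → B) xs f → ∑ (List.map g xs) f ≡ ∑ xs (f ∘ g)
∑-map g []       f = refl
∑-map g (x ∷ xs) f = cong (λ i → f (g x) + i) (∑-map g xs f)

∑-cong : ∀ (xs : List A) {f g} → (∀ x → f x ≡ g x) → ∑ xs f ≡ ∑ xs g
∑-cong []       eq = refl
∑-cong (x ∷ xs) eq = cong₂ _+_ (eq x) (∑-cong xs eq)

∑-neg : ∀ (xs : List A) f → ∑ xs (-_ ∘ f) ≡ - ∑ xs f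
∑-neg []       f = refl
∑-neg (x ∷ xs) f = trans (cong (λ i → - f x + i) (∑-neg xs f)) (sym (ℤ.neg-distrib-+ (f x) _))

𝟙 : Dec P → ℤ
𝟙 d = if does d then 1ℤ else 0ℤ

𝟙-⇔ : P ⇔ Q → (p? : Dec P) (q? : Dec Q) → 𝟙 p? ≡ 𝟙 q?
𝟙-⇔ P⇔Q p? q? = cong (if_then 1ℤ else 0ℤ) (does-⇔ P⇔Q p? q?)

𝟙-yes : (p? : Dec P) → P → 𝟙 p? ≡ 1ℤ
𝟙-yes p? p = cong (if_then 1ℤ else 0ℤ) (dec-true p? p)

𝟙-no : (p? : Dec P) → ¬ P → 𝟙 p? ≡ 0ℤ
𝟙-no p? ¬p = cong (if_then 1ℤ else 0ℤ) (dec-false p? ¬p)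

∑-filter : ∀ {R : Pred A _} (R? : Decidable R) xs f →
           ∑ (filter R? xs) f ≡ ∑ xs (λ x → 𝟙 (R? x) * f x)
∑-filter R? []       f = refl
∑-filter R? (x ∷ xs) f with does (R? x)
... | true  = cong₂ _+_ (sym (ℤ.*-identityˡ (f x))) (∑-filter R? xs f)
... | false = trans (∑-filter R? xs f)
                    (sym (trans (cong (_+ rest) (ℤ.*-zeroˡ (f x))) (ℤ.+-identityˡ rest)))
  where rest = ∑ xs (λ y → 𝟙 (R? y) * f y)

-- alt N f is the sum of (-1)^|T| f(T) over all T ⊆ {0, …, N-1}.
alt : ∀ N → (Subset N → ℤ) → ℤ
alt zero    f = f []
alt (suc N) f = alt N (f ∘ (outside ∷_)) - alt N (f ∘ (inside ∷_))

alt-cong : ∀ N {f g} → (∀ T → f T ≡ g T) → alt N f ≡ alt N g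
alt-cong zero    eq = eq []
alt-cong (suc N) eq = cong₂ _-_ (alt-cong N (eq ∘ (outside ∷_))) (alt-cong N (eq ∘ (inside ∷_)))

alt-0 : ∀ N → alt N (λ _ → 0ℤ) ≡ 0ℤ
alt-0 zero    = refl
alt-0 (suc N) = ℤ.+-inverseʳ (alt N (λ _ → 0ℤ))

alt-minus : ∀ N f g → alt N (λ T → f T - g T) ≡ alt N f - alt N g
alt-minus zero    f g = refl
alt-minus (suc N) f g = trans
  (cong₂ _-_ (alt-minus N (f ∘ (outside ∷_)) (g ∘ (outside ∷_)))
             (alt-minus N (f ∘ (inside ∷_)) (g ∘ (inside ∷_))))
  (interchange (alt N (f ∘ (outside ∷_))) (alt N (g ∘ (outside ∷_)))
               (alt N (f ∘ (inside ∷_))) (alt N (g ∘ (inside ∷_))))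
  where
  interchange : ∀ a b c d → (a - b) - (c - d) ≡ (a - c) - (b - d)
  interchange = solve-∀

alt-++ : ∀ j {k} f → alt (j ℕ.+ k) f ≡ alt j (λ a → alt k (λ b → f (a Vec.++ b)))
alt-++ zero    f = refl
alt-++ (suc j) f = cong₂ _-_ (alt-++ j (f ∘ (outside ∷_))) (alt-++ j (f ∘ (inside ∷_)))

alt-nonempty : ∀ j x y → alt (suc j) (λ a → if does (nonempty? a) then y else x) ≡ x - y
alt-nonempty j x y = trans (go (suc j))
  (trans (cong (λ i → (x - y) + i) (ℤ.+-inverseʳ (alt j (λ _ → y)))) (ℤ.+-identityʳ (x - y)))
  where
  branch : Bool → ℤ
  branch b = if b then y else x

  drop-outside : ∀ {n} {a : Subset n} → Nonempty (outside ∷ a) ⇔ Nonempty a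
  drop-outside = mk⇔ (λ { (suc i , i∈) → i , drop-there i∈ }) (λ (i , i∈) → suc i , Vec.there i∈)

  cancel : ∀ x y → x ≡ (x - y) + y
  cancel = solve-∀

  go : ∀ j → alt j (λ a → branch (does (nonempty? a))) ≡ (x - y) + alt j (λ _ → y)
  go zero    = cancel x y
  go (suc j) = trans
    (cong₂ _-_
      (trans (alt-cong j λ a → cong branch
                (does-⇔ drop-outside (nonempty? (outside ∷ a)) (nonempty? a)))
             (go j))
      (alt-cong j λ a → cong branch (dec-true (nonempty? (inside ∷ a)) (zero , Vec.here))))
    (ℤ.+-assoc (x - y) (alt j (λ _ → y)) (- alt j (λ _ → y)))

𝟙-empty : (P : Subset N) → 𝟙 (¬? (nonempty? P)) ≡ alt N (λ T → 𝟙 (T ⊆? P))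
𝟙-empty []            = refl
𝟙-empty {suc N} (inside ∷ P) = trans
  (𝟙-no (¬? (nonempty? (inside ∷ P))) (λ e → e (zero , Vec.here)))
  (sym (ℤ.+-inverseʳ (alt N (λ T → 𝟙 (T ⊆? P)))))
𝟙-empty {suc N} (outside ∷ P) = begin
  𝟙 (¬? (nonempty? (outside ∷ P)))  ≡⟨ 𝟙-⇔ (mk⇔ (λ { e (i , i∈) → e (suc i , Vec.there i∈) })
                                              (λ { e (suc i , i∈) → e (i , drop-there i∈) }))
                                           (¬? (nonempty? (outside ∷ P))) (¬? (nonempty? P)) ⟩
  𝟙 (¬? (nonempty? P))              ≡⟨ 𝟙-empty P ⟩
  alt N (λ T → 𝟙 (T ⊆? P))          ≡⟨ ℤ.+-identityʳ _ ⟨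
  alt N (λ T → 𝟙 (T ⊆? P)) - 0ℤ     ≡⟨ cong (λ i → alt N (λ T → 𝟙 (T ⊆? P)) - i) (alt-0 N) ⟨
  alt N (λ T → 𝟙 (T ⊆? P)) - alt N (λ _ → 0ℤ) ∎
  where open ≡-Reasoning

𝟙-⊆-∩ : (T P Q : Subset N) → 𝟙 (T ⊆? P ∩ Q) ≡ 𝟙 (T ⊆? P) * 𝟙 (T ⊆? Q)
𝟙-⊆-∩ T P Q with T ⊆? P | T ⊆? Q
... | yes T⊆P | yes T⊆Q = 𝟙-yes (T ⊆? P ∩ Q) (λ x∈ → x∈p∩q⁺ (T⊆P x∈ , T⊆Q x∈))
... | yes _   | no T⊈Q  = 𝟙-no (T ⊆? P ∩ Q) (λ T⊆ → T⊈Q (λ x∈ → proj₂ (x∈p∩q⁻ P Q (T⊆ x∈))))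
... | no T⊈P  | _       = 𝟙-no (T ⊆? P ∩ Q) (λ T⊆ → T⊈P (λ x∈ → proj₁ (x∈p∩q⁻ P Q (T⊆ x∈))))

module _ (z : A → Subset N) where

  missed : List A → Subset N → ℤ
  missed []       T = 1ℤ
  missed (x ∷ xs) T = (1ℤ - 𝟙 (T ⊆? z x)) * missed xs T

  missed≡0 : ∀ xs {T x} → x ∈ˡ xs → T ⊆ z x → missed xs T ≡ 0ℤ
  missed≡0 (x ∷ xs) {T} (here refl) T⊆ =
    trans (cong (λ i → (1ℤ - i) * missed xs T) (𝟙-yes (T ⊆? z x) T⊆)) (ℤ.*-zeroˡ (missed xs T))
  missed≡0 (y ∷ xs) {T} (there x∈) T⊆ =
    trans (cong ((1ℤ - 𝟙 (T ⊆? z y)) *_) (missed≡0 xs x∈ T⊆)) (ℤ.*-zeroʳ (1ℤ - 𝟙 (T ⊆? z y)))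

  missed≡1 : ∀ xs {T} → (∀ {x} → x ∈ˡ xs → ¬ T ⊆ z x) → missed xs T ≡ 1ℤ
  missed≡1 []       _ = refl
  missed≡1 (x ∷ xs) {T} ⊈ = cong₂ (λ i m → (1ℤ - i) * m)
    (𝟙-no (T ⊆? z x) (⊈ (here refl))) (missed≡1 xs (⊈ ∘ there))

  coverSum : Subset N → List A → ℤ
  coverSum P xs =
    ∑ (sublists xs) (λ S → 𝟙 (¬? (nonempty? (P ∩ ⋂ (List.map z S)))) * -1ℤ ^ length S)

  coverSum-∷ : ∀ P x xs → coverSum P (x ∷ xs) ≡ coverSum P xs - coverSum (P ∩ z x) xs
  coverSum-∷ P x xs = begin
    coverSum P (x ∷ xs)                      ≡⟨ ∑-++ (List.map (x ∷_) (sublists xs)) (sublists xs) w ⟩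
    ∑ (List.map (x ∷_) (sublists xs)) w + coverSum P xs
      ≡⟨ cong (_+ coverSum P xs) (∑-map (x ∷_) (sublists xs) w) ⟩
    ∑ (sublists xs) (w ∘ (x ∷_)) + coverSum P xs
      ≡⟨ cong (_+ coverSum P xs) (trans (∑-cong (sublists xs) step) (∑-neg (sublists xs) w′)) ⟩
    - coverSum (P ∩ z x) xs + coverSum P xs  ≡⟨ ℤ.+-comm _ (coverSum P xs) ⟩
    coverSum P xs - coverSum (P ∩ z x) xs    ∎
    where
    open ≡-Reasoning
    w w′ : List A → ℤ
    w  S = 𝟙 (¬? (nonempty? (P ∩ ⋂ (List.map z S)))) * -1ℤ ^ length S
    w′ S = 𝟙 (¬? (nonempty? ((P ∩ z x) ∩ ⋂ (List.map z S)))) * -1ℤ ^ length S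

    pull-neg : ∀ a b → a * (-1ℤ * b) ≡ - (a * b)
    pull-neg = solve-∀

    step : ∀ S → w (x ∷ S) ≡ - w′ S
    step S = trans
      (cong (λ R → 𝟙 (¬? (nonempty? R)) * -1ℤ ^ suc (length S))
            (sym (∩-assoc P (z x) (⋂ (List.map z S)))))
      (pull-neg (𝟙 (¬? (nonempty? ((P ∩ z x) ∩ ⋂ (List.map z S))))) (-1ℤ ^ length S))

  coverSum-alt : ∀ xs P → coverSum P xs ≡ alt N (λ T → 𝟙 (T ⊆? P) * missed xs T)
  coverSum-alt [] P = begin
    𝟙 (¬? (nonempty? (P ∩ ⊤))) * 1ℤ + 0ℤ ≡⟨ trans (ℤ.+-identityʳ _) (ℤ.*-identityʳ _) ⟩
    𝟙 (¬? (nonempty? (P ∩ ⊤)))           ≡⟨ cong (λ R → 𝟙 (¬? (nonempty? R))) (∩-identityʳ P) ⟩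
    𝟙 (¬? (nonempty? P))                 ≡⟨ 𝟙-empty P ⟩
    alt N (λ T → 𝟙 (T ⊆? P))             ≡⟨ alt-cong N (λ T → ℤ.*-identityʳ _) ⟨
    alt N (λ T → 𝟙 (T ⊆? P) * 1ℤ)        ∎
    where open ≡-Reasoning
  coverSum-alt (x ∷ xs) P = begin
    coverSum P (x ∷ xs)                    ≡⟨ coverSum-∷ P x xs ⟩
    coverSum P xs - coverSum (P ∩ z x) xs  ≡⟨ cong₂ _-_ (coverSum-alt xs P) (coverSum-alt xs (P ∩ z x)) ⟩
    alt N (λ T → 𝟙 (T ⊆? P) * missed xs T) - alt N (λ T → 𝟙 (T ⊆? P ∩ z x) * missed xs T)
      ≡⟨ alt-minus N _ _ ⟨
    alt N (λ T → 𝟙 (T ⊆? P) * missed xs T - 𝟙 (T ⊆? P ∩ z x) * missed xs T)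
      ≡⟨ alt-cong N (λ T → trans
           (cong (λ i → 𝟙 (T ⊆? P) * missed xs T - i * missed xs T) (𝟙-⊆-∩ T P (z x)))
           (factor (𝟙 (T ⊆? P)) (𝟙 (T ⊆? z x)) (missed xs T))) ⟩
    alt N (λ T → 𝟙 (T ⊆? P) * missed (x ∷ xs) T) ∎
    where
    open ≡-Reasoning
    factor : ∀ a b m → a * m - (a * b) * m ≡ a * ((1ℤ - b) * m)
    factor = solve-∀

-- The condition S ≢ [] in IsEZ is automatic, since ⋂ [] = ⊤ has an element for N > 0.
EZ-alt : ∀ {k N} (σ : Permutation′ k) (π : Permutation′ N) → 0 < N →
         EZ σ π ≡ alt N (missed Z (Ê σ π))
EZ-alt {N = N} σ π 0<N = begin
  EZ σ π                                            ≡⟨ ∑-filter isEZ? (sublists (Ê σ π)) _ ⟩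
  ∑ (sublists (Ê σ π)) (λ S → 𝟙 (isEZ? S) * -1ℤ ^ length S)
    ≡⟨ ∑-cong (sublists (Ê σ π)) (λ S → cong (_* -1ℤ ^ length S)
         (𝟙-⇔ (isEZ⇔ S) (isEZ? S) (¬? (nonempty? (⊤ ∩ ⋂ (List.map Z S)))))) ⟩
  coverSum Z ⊤ (Ê σ π)                              ≡⟨ coverSum-alt Z (Ê σ π) ⊤ ⟩
  alt N (λ T → 𝟙 (T ⊆? ⊤) * missed Z (Ê σ π) T)
    ≡⟨ alt-cong N (λ T → trans (cong (_* missed Z (Ê σ π) T) (𝟙-yes (T ⊆? ⊤) ⊆⊤)) (ℤ.*-identityˡ _)) ⟩
  alt N (missed Z (Ê σ π))                          ∎
  where
  open ≡-Reasoning
  isEZ⇔ : ∀ S → IsEZ S ⇔ Empty (⊤ {N} ∩ ⋂ (List.map Z S))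
  isEZ⇔ S rewrite ∩-identityˡ (⋂ (List.map Z S)) =
    mk⇔ proj₂ (λ e → (λ { refl → e (fromℕ< 0<N , ∈⊤) }) , e)

-- Order isomorphism of words

data Aligned {A B : Set} (x : A) (y : B) : List A → List B → Set where
  here  : Aligned x y (x ∷ xs) (y ∷ ys)
  there : Aligned x y xs ys → Aligned x y (x′ ∷ xs) (y′ ∷ ys)

aligned-lookup : (e : length xs ≡ length ys) (i : Fin (length xs)) →
                 Aligned (List.lookup xs i) (List.lookup ys (cast e i)) xs ys
aligned-lookup {xs = _ ∷ _} {ys = _ ∷ _} e zero    = here
aligned-lookup {xs = _ ∷ _} {ys = _ ∷ _} e (suc i) = there (aligned-lookup (ℕ.suc-injective e) i)

aligned⇒lookup : Aligned x y xs ys → (e : length xs ≡ length ys) →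
                 ∃ λ i → List.lookup xs i ≡ x × List.lookup ys (cast e i) ≡ y
aligned⇒lookup here      e = zero , refl , refl
aligned⇒lookup (there a) e with i , p , q ← aligned⇒lookup a (ℕ.suc-injective e) = suc i , p , q

aligned-++ˡ : Aligned x y xs us → Aligned x y (xs ++ ys) (us ++ vs)
aligned-++ˡ here      = here
aligned-++ˡ (there a) = there (aligned-++ˡ a)

aligned-++ʳ : ∀ xs us → length xs ≡ length us →
              Aligned x y ys vs → Aligned x y (xs ++ ys) (us ++ vs)
aligned-++ʳ []       []       e a = a
aligned-++ʳ (_ ∷ xs) (_ ∷ us) e a = there (aligned-++ʳ xs us (ℕ.suc-injective e) a)

aligned-++⁻ : ∀ xs us → length xs ≡ length us →
              Aligned x y (xs ++ ys) (us ++ vs) → Aligned x y xs us ⊎ Aligned x y ys vs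
aligned-++⁻ []       []       e a         = inj₂ a
aligned-++⁻ (_ ∷ xs) (_ ∷ us) e here      = inj₁ here
aligned-++⁻ (_ ∷ xs) (_ ∷ us) e (there a) with aligned-++⁻ xs us (ℕ.suc-injective e) a
... | inj₁ b = inj₁ (there b)
... | inj₂ b = inj₂ b

aligned-map⁺ : ∀ {C D : Set} (f : A → C) (g : B → D) {x : A} {y : B} {xs ys} →
               Aligned x y xs ys → Aligned (f x) (g y) (List.map f xs) (List.map g ys)
aligned-map⁺ f g here      = here
aligned-map⁺ f g (there a) = there (aligned-map⁺ f g a)

aligned-map⁻ : ∀ {C D : Set} (f : A → C) (g : B → D) {x y} xs ys →
               Aligned x y (List.map f xs) (List.map g ys) →
               ∃₂ λ x′ y′ → x ≡ f x′ × y ≡ g y′ × Aligned x′ y′ xs ys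
aligned-map⁻ f g (x ∷ xs) (y ∷ ys) here      = x , y , refl , refl , here
aligned-map⁻ f g (_ ∷ xs) (_ ∷ ys) (there a)
  with x , y , p , q , b ← aligned-map⁻ f g xs ys a = x , y , p , q , there b

aligned⇒∈ˡ : Aligned x y xs ys → x ∈ˡ xs
aligned⇒∈ˡ here      = here refl
aligned⇒∈ˡ (there a) = there (aligned⇒∈ˡ a)

aligned⇒∈ʳ : Aligned x y xs ys → y ∈ˡ ys
aligned⇒∈ʳ here      = here refl
aligned⇒∈ʳ (there a) = there (aligned⇒∈ʳ a)

∈⇒aligned : length xs ≡ length ys → y ∈ˡ ys → ∃ λ x → Aligned x y xs ys
∈⇒aligned {xs = x ∷ xs} e (here refl) = x , here
∈⇒aligned {xs = _ ∷ xs} e (there y∈)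
  with x , a ← ∈⇒aligned (ℕ.suc-injective e) y∈ = x , there a

aligned-refl⇒≡ : Aligned x y xs xs → x ≡ y
aligned-refl⇒≡ here      = refl
aligned-refl⇒≡ (there a) = aligned-refl⇒≡ a

OrderIso : List ℕ → List ℕ → Set
OrderIso xs ys = length xs ≡ length ys ×
  (∀ {x y x′ y′} → Aligned x y xs ys → Aligned x′ y′ xs ys → (x < x′) ⇔ (y < y′))

sameOrder⇒orderIso : SameOrder xs ys → OrderIso xs ys
sameOrder⇒orderIso {xs} {ys} (e , iso) = e , λ a a′ → transport a a′
  where
  transport : ∀ {x y x′ y′} → Aligned x y xs ys → Aligned x′ y′ xs ys → (x < x′) ⇔ (y < y′)
  transport a a′ with i , refl , refl ← aligned⇒lookup a e
                    | j , refl , refl ← aligned⇒lookup a′ e = iso i j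

orderIso⇒sameOrder : OrderIso xs ys → SameOrder xs ys
orderIso⇒sameOrder (e , iso) = e , λ i j → iso (aligned-lookup e i) (aligned-lookup e j)

orderIso-shift⁺ : ∀ j k → OrderIso xs ys → OrderIso (List.map (j ℕ.+_) xs) (List.map (k ℕ.+_) ys)
orderIso-shift⁺ {xs} {ys} j k (e , iso) =
  trans (List.length-map (j ℕ.+_) xs) (trans e (sym (List.length-map (k ℕ.+_) ys))) , shifted
  where
  shifted : ∀ {x y x′ y′} → Aligned x y (List.map (j ℕ.+_) xs) (List.map (k ℕ.+_) ys) →
            Aligned x′ y′ (List.map (j ℕ.+_) xs) (List.map (k ℕ.+_) ys) → (x < x′) ⇔ (y < y′)
  shifted a a′ with _ , _ , refl , refl , b  ← aligned-map⁻ (j ℕ.+_) (k ℕ.+_) xs ys a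
                  | _ , _ , refl , refl , b′ ← aligned-map⁻ (j ℕ.+_) (k ℕ.+_) xs ys a′ =
    mk⇔ (λ lt → ℕ.+-monoʳ-< k (Equivalence.to (iso b b′) (ℕ.+-cancelˡ-< j _ _ lt)))
        (λ lt → ℕ.+-monoʳ-< j (Equivalence.from (iso b b′) (ℕ.+-cancelˡ-< k _ _ lt)))

orderIso-shift⁻ : ∀ j k → OrderIso (List.map (j ℕ.+_) xs) (List.map (k ℕ.+_) ys) → OrderIso xs ys
orderIso-shift⁻ {xs} {ys} j k (e , iso) =
  trans (sym (List.length-map (j ℕ.+_) xs)) (trans e (List.length-map (k ℕ.+_) ys)) ,
  λ a a′ → let i = iso (aligned-map⁺ (j ℕ.+_) (k ℕ.+_) a) (aligned-map⁺ (j ℕ.+_) (k ℕ.+_) a′) in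
    mk⇔ (λ lt → ℕ.+-cancelˡ-< k _ _ (Equivalence.to i (ℕ.+-monoʳ-< j lt)))
        (λ lt → ℕ.+-cancelˡ-< j _ _ (Equivalence.from i (ℕ.+-monoʳ-< k lt)))

Below : List ℕ → List ℕ → Set
Below xs ys = ∀ {x y} → x ∈ˡ xs → y ∈ˡ ys → x < y

orderIso-++⁺ : ∀ ws → Below ws xs → Below ws ys → OrderIso xs ys → OrderIso (ws ++ xs) (ws ++ ys)
orderIso-++⁺ {xs} {ys} ws ws<xs ws<ys (e , iso) =
  trans (List.length-++ ws) (trans (cong (length ws ℕ.+_) e) (sym (List.length-++ ws))) , glued
  where
  glued : ∀ {x y x′ y′} → Aligned x y (ws ++ xs) (ws ++ ys) →
          Aligned x′ y′ (ws ++ xs) (ws ++ ys) → (x < x′) ⇔ (y < y′)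
  glued a a′ with aligned-++⁻ ws ws refl a | aligned-++⁻ ws ws refl a′
  ... | inj₁ b | inj₁ b′ rewrite aligned-refl⇒≡ b | aligned-refl⇒≡ b′ = mk⇔ (λ lt → lt) (λ lt → lt)
  ... | inj₁ b | inj₂ b′ = mk⇔ (λ _ → ws<ys (aligned⇒∈ʳ b) (aligned⇒∈ʳ b′))
                               (λ _ → ws<xs (aligned⇒∈ˡ b) (aligned⇒∈ˡ b′))
  ... | inj₂ b | inj₁ b′ = mk⇔
    (λ lt → contradiction lt (ℕ.<-asym (ws<xs (aligned⇒∈ˡ b′) (aligned⇒∈ˡ b))))
    (λ lt → contradiction lt (ℕ.<-asym (ws<ys (aligned⇒∈ʳ b′) (aligned⇒∈ʳ b))))
  ... | inj₂ b | inj₂ b′ = iso b b′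

orderIso-++⁻ : ∀ ws → OrderIso (ws ++ xs) (ws ++ ys) → OrderIso xs ys
orderIso-++⁻ ws (e , iso) =
  ℕ.+-cancelˡ-≡ (length ws) _ _ (trans (sym (List.length-++ ws)) (trans e (List.length-++ ws))) ,
  λ a a′ → iso (aligned-++ʳ ws ws refl a) (aligned-++ʳ ws ws refl a′)

orderIso-below : ∀ xs us → length xs ≡ length us → Below xs ys →
                 OrderIso (xs ++ ys) (us ++ vs) → Below us vs
orderIso-below {ys} {vs} xs us |xs|≡|us| xs<ys (e , iso) u∈ v∈ =
  Equivalence.to (iso (aligned-++ˡ (proj₂ left)) (aligned-++ʳ xs us |xs|≡|us| (proj₂ right)))
    (xs<ys (aligned⇒∈ˡ (proj₂ left)) (aligned⇒∈ˡ (proj₂ right)))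
  where
  |ys|≡|vs| : length ys ≡ length vs
  |ys|≡|vs| = ℕ.+-cancelˡ-≡ (length xs) _ _ (trans (sym (List.length-++ xs))
    (trans e (trans (List.length-++ us) (cong (ℕ._+ length vs) (sym |xs|≡|us|)))))
  left  = ∈⇒aligned |xs|≡|us| u∈
  right = ∈⇒aligned |ys|≡|vs| v∈

-- Direct sums and decomposability

side : ∀ j (x : Fin (j ℕ.+ k)) → (∃ λ i → x ≡ i ↑ˡ k) ⊎ (∃ λ i → x ≡ j ↑ʳ i)
side j x with splitAt j x in eq
... | inj₁ i = inj₁ (i , sym (Fin.splitAt⁻¹-↑ˡ eq))
... | inj₂ i = inj₂ (i , sym (Fin.splitAt⁻¹-↑ʳ eq))

⊕-↑ˡ : (σ : Permutation′ j) (τ : Permutation′ k) → ∀ i → σ ⊕ τ ⟨$⟩ʳ (i ↑ˡ k) ≡ (σ ⟨$⟩ʳ i) ↑ˡ k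
⊕-↑ˡ {j} {k} σ τ i rewrite Fin.splitAt-↑ˡ j i k = refl

⊕-↑ʳ : (σ : Permutation′ j) (τ : Permutation′ k) → ∀ i → σ ⊕ τ ⟨$⟩ʳ (j ↑ʳ i) ≡ j ↑ʳ (τ ⟨$⟩ʳ i)
⊕-↑ʳ {j} {k} σ τ i rewrite Fin.splitAt-↑ʳ j k i = refl

letter-⊕ˡ : (σ : Permutation′ j) (τ : Permutation′ k) → ∀ i → letter (σ ⊕ τ) (i ↑ˡ k) ≡ letter σ i
letter-⊕ˡ σ τ i = cong suc (trans (cong toℕ (⊕-↑ˡ σ τ i)) (Fin.toℕ-↑ˡ _ _))

letter-⊕ʳ : (σ : Permutation′ j) (τ : Permutation′ k) → ∀ i → letter (σ ⊕ τ) (j ↑ʳ i) ≡ j ℕ.+ letter τ i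
letter-⊕ʳ {j} σ τ i =
  trans (cong suc (trans (cong toℕ (⊕-↑ʳ σ τ i)) (Fin.toℕ-↑ʳ j _))) (sym (ℕ.+-suc j _))

letter≤ : (π : Permutation′ n) → ∀ i → letter π i ≤ n
letter≤ π i = Fin.toℕ<n (π ⟨$⟩ʳ i)

pick : (Fin n → A) → Subset n → List A
pick f []            = []
pick f (inside  ∷ p) = f zero ∷ pick (f ∘ suc) p
pick f (outside ∷ p) = pick (f ∘ suc) p

pick-cong : ∀ {f g : Fin n → A} → (∀ i → f i ≡ g i) → ∀ p → pick f p ≡ pick g p
pick-cong eq []            = refl
pick-cong eq (inside  ∷ p) = cong₂ _∷_ (eq zero) (pick-cong (eq ∘ suc) p)
pick-cong eq (outside ∷ p) = pick-cong (eq ∘ suc) p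

pick-map : ∀ (g : A → B) (f : Fin n → A) p → pick (g ∘ f) p ≡ List.map g (pick f p)
pick-map g f []            = refl
pick-map g f (inside  ∷ p) = cong (g (f zero) ∷_) (pick-map g (f ∘ suc) p)
pick-map g f (outside ∷ p) = pick-map g (f ∘ suc) p

pick-++ : ∀ (f : Fin (j ℕ.+ k) → A) (a : Subset j) (b : Subset k) →
          pick f (a Vec.++ b) ≡ pick (f ∘ (_↑ˡ k)) a ++ pick (f ∘ (j ↑ʳ_)) b
pick-++ f []            b = refl
pick-++ f (inside  ∷ a) b = cong (f zero ∷_) (pick-++ (f ∘ suc) a b)
pick-++ f (outside ∷ a) b = pick-++ (f ∘ suc) a b

length-pick : ∀ (f : Fin n → A) p → length (pick f p) ≡ ∣ p ∣
length-pick f []            = refl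
length-pick f (inside  ∷ p) = cong suc (length-pick (f ∘ suc) p)
length-pick f (outside ∷ p) = length-pick (f ∘ suc) p

pick-⊥ : ∀ n (f : Fin n → A) → pick f ⊥ ≡ []
pick-⊥ zero    f = refl
pick-⊥ (suc n) f = pick-⊥ n (f ∘ suc)

∈-pick⁻ : ∀ (f : Fin n → A) p {x} → x ∈ˡ pick f p → ∃ λ i → x ≡ f i
∈-pick⁻ f (inside  ∷ p) (here refl) = zero , refl
∈-pick⁻ f (inside  ∷ p) (there x∈)  with i , eq ← ∈-pick⁻ (f ∘ suc) p x∈ = suc i , eq
∈-pick⁻ f (outside ∷ p) x∈          with i , eq ← ∈-pick⁻ (f ∘ suc) p x∈ = suc i , eq

∈-pick-⊤ : ∀ (f : Fin n → A) i → f i ∈ˡ pick f ⊤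
∈-pick-⊤ f zero    = here refl
∈-pick-⊤ f (suc i) = there (∈-pick-⊤ (f ∘ suc) i)

tabulate≡pick-⊤ : ∀ n (f : Fin n → A) → List.tabulate f ≡ pick f ⊤
tabulate≡pick-⊤ zero    f = refl
tabulate≡pick-⊤ (suc n) f = cong (f zero ∷_) (tabulate≡pick-⊤ n (f ∘ suc))

word≡pick : (π : Permutation′ n) → word π ≡ pick (letter π) ⊤
word≡pick {n} π = trans (List.map-tabulate id (letter π)) (tabulate≡pick-⊤ n (letter π))

lettersAt≡pick : (π : Permutation′ n) (p : Subset n) → lettersAt π p ≡ pick (letter π) p
lettersAt≡pick π = go (letter π)
  where
  filter-suc : ∀ {n} s (p : Subset n) xs →
               filter (_∈? (s ∷ p)) (List.map suc xs) ≡ List.map suc (filter (_∈? p) xs)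
  filter-suc s p []       = refl
  filter-suc s p (x ∷ xs) with does (x ∈? p)
  ... | true  = cong (suc x ∷_) (filter-suc s p xs)
  ... | false = filter-suc s p xs

  go : ∀ {n} (f : Fin n → ℕ) p → List.map f (filter (_∈? p) (allFin n)) ≡ pick f p
  tail : ∀ {n} (f : Fin (suc n) → ℕ) s p →
         List.map f (filter (_∈? (s ∷ p)) (List.tabulate suc)) ≡ pick (f ∘ suc) p
  go f []            = refl
  go f (inside  ∷ p) = cong (f zero ∷_) (tail f inside p)
  go f (outside ∷ p) = tail f outside p
  tail {n} f s p = begin
    List.map f (filter (_∈? (s ∷ p)) (List.tabulate suc))
      ≡⟨ cong (List.map f ∘ filter (_∈? (s ∷ p))) (List.map-tabulate id suc) ⟨
    List.map f (filter (_∈? (s ∷ p)) (List.map suc (allFin n)))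
      ≡⟨ cong (List.map f) (filter-suc s p (allFin n)) ⟩
    List.map f (List.map suc (filter (_∈? p) (allFin n)))
      ≡⟨ List.map-∘ (filter (_∈? p) (allFin n)) ⟨
    List.map (f ∘ suc) (filter (_∈? p) (allFin n))
      ≡⟨ go (f ∘ suc) p ⟩
    pick (f ∘ suc) p ∎
    where open ≡-Reasoning

pick-⊕ : (σ : Permutation′ j) (τ : Permutation′ k) (a : Subset j) (b : Subset k) →
         pick (letter (σ ⊕ τ)) (a Vec.++ b) ≡
         pick (letter σ) a ++ List.map (j ℕ.+_) (pick (letter τ) b)
pick-⊕ {j} σ τ a b = trans (pick-++ (letter (σ ⊕ τ)) a b)
  (cong₂ _++_ (pick-cong (letter-⊕ˡ σ τ) a)
              (trans (pick-cong (letter-⊕ʳ σ τ) b) (pick-map (j ℕ.+_) (letter τ) b)))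

pick-⊥-⊕ : (σ : Permutation′ j) (τ : Permutation′ k) (b : Subset k) →
           pick (letter (σ ⊕ τ)) (⊥ {j} Vec.++ b) ≡ List.map (j ℕ.+_) (pick (letter τ) b)
pick-⊥-⊕ {j} σ τ b = trans (pick-⊕ σ τ ⊥ b)
  (cong (_++ List.map (j ℕ.+_) (pick (letter τ) b)) (pick-⊥ j (letter σ)))

pick-below : (σ : Permutation′ j) (τ : Permutation′ k) (a : Subset j) (b : Subset k) →
             Below (pick (letter σ) a) (List.map (j ℕ.+_) (pick (letter τ) b))
pick-below {j} σ τ a b x∈ y∈
  with i , refl ← ∈-pick⁻ (letter σ) a x∈ | _ , y′∈ , refl ← ∈-map⁻ (j ℕ.+_) y∈
  with i′ , refl ← ∈-pick⁻ (letter τ) b y′∈ = begin-strict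
    letter σ i        ≤⟨ letter≤ σ i ⟩
    j                 <⟨ ℕ.m<m+n j (s≤s z≤n) ⟩
    j ℕ.+ letter τ i′ ∎
  where open ℕ.≤-Reasoning

⊤-++ : ∀ j {k} → ⊤ {j ℕ.+ k} ≡ ⊤ {j} Vec.++ ⊤ {k}
⊤-++ zero    = refl
⊤-++ (suc j) = cong (inside ∷_) (⊤-++ j)

restrict : (ι : Fin j → Fin n) → (∀ {x y} → ι x ≡ ι y → x ≡ y) → (π : Permutation′ n) →
           (∀ i → ∃ λ i′ → π ⟨$⟩ʳ ι i ≡ ι i′) → (∀ i → ∃ λ i′ → π ⟨$⟩ˡ ι i ≡ ι i′) →
           Σ (Permutation′ j) λ σ → ∀ i → π ⟨$⟩ʳ ι i ≡ ι (σ ⟨$⟩ʳ i)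
restrict ι ι-inj π f g = permutation (proj₁ ∘ f) (proj₁ ∘ g)
    (λ i → ι-inj (trans (sym (proj₂ (f (proj₁ (g i)))))
                 (trans (cong (π ⟨$⟩ʳ_) (sym (proj₂ (g i)))) (inverseʳ π))))
    (λ i → ι-inj (trans (sym (proj₂ (g (proj₁ (f i)))))
                 (trans (cong (π ⟨$⟩ˡ_) (sym (proj₂ (f i)))) (inverseˡ π))))
  , proj₂ ∘ f

⟨$⟩ʳ-injective : (π : Permutation′ n) → ∀ {x y} → π ⟨$⟩ʳ x ≡ π ⟨$⟩ʳ y → x ≡ y
⟨$⟩ʳ-injective π eq = trans (sym (inverseˡ π)) (trans (cong (π ⟨$⟩ˡ_) eq) (inverseˡ π))

bounded-injection : (f : Fin k → Fin n) → (∀ {x y} → f x ≡ f y → x ≡ y) →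
                    ∀ {b} → (∀ i → toℕ (f i) < b) → k ≤ b
bounded-injection f f-inj f<b = Fin.injective⇒≤ {f = λ i → fromℕ< (f<b i)} λ {x} {y} eq →
  f-inj (Fin.toℕ-injective (Fin.fromℕ<-injective _ _ (f<b x) (f<b y) eq))

ascending⇒decomposable : ∀ k r → 0 < k → 0 < r → (π : Permutation′ (k ℕ.+ r)) →
  (∀ i j → letter π (i ↑ˡ r) < letter π (k ↑ʳ j)) → Decomposable π
ascending⇒decomposable k r 0<k 0<r π asc =
  2 , ℕ.≤-refl , cons {σ = proj₁ σ} {τ = proj₁ τ} (ℕ.>-nonZero 0<k) (single (ℕ.>-nonZero 0<r)) π≈σ⊕τ
  where
  high : ∀ j → k ≤ toℕ (π ⟨$⟩ʳ (k ↑ʳ j))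
  high j = bounded-injection (λ i → π ⟨$⟩ʳ (i ↑ˡ r))
    (λ eq → Fin.↑ˡ-injective r _ _ (⟨$⟩ʳ-injective π eq)) (λ i → ℕ.≤-pred (asc i j))

  low : ∀ i → toℕ (π ⟨$⟩ʳ (i ↑ˡ r)) < k
  low i = ℕ.+-cancelʳ-≤ r _ _ (ℕ.≤-trans (ℕ.≤-reflexive (ℕ.+-comm (suc u) r))
            (ℕ.≤-trans (ℕ.+-monoˡ-≤ (suc u) r≤) (ℕ.≤-reflexive (ℕ.m∸n+n≡m u<))))
    where
    u = toℕ (π ⟨$⟩ʳ (i ↑ˡ r))
    u< : u < k ℕ.+ r
    u< = Fin.toℕ<n (π ⟨$⟩ʳ (i ↑ˡ r))

    r≤ : r ≤ (k ℕ.+ r) ∸ suc u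
    r≤ = bounded-injection (λ j → opposite (π ⟨$⟩ʳ (k ↑ʳ j)))
      (λ eq → Fin.↑ʳ-injective k _ _ (⟨$⟩ʳ-injective π
        (trans (sym (Fin.opposite-involutive _)) (trans (cong opposite eq) (Fin.opposite-involutive _)))))
      (λ j → ℕ.≤-trans (ℕ.≤-reflexive (cong suc (Fin.opposite-prop (π ⟨$⟩ʳ (k ↑ʳ j)))))
               (ℕ.∸-monoʳ-< (asc i j) (Fin.toℕ<n (π ⟨$⟩ʳ (k ↑ʳ j)))))

  toˡ : ∀ i → ∃ λ i′ → π ⟨$⟩ʳ (i ↑ˡ r) ≡ i′ ↑ˡ r
  toˡ i with side k (π ⟨$⟩ʳ (i ↑ˡ r))
  ... | inj₁ l = l
  ... | inj₂ (i′ , eq) = contradiction (low i) (ℕ.≤⇒≯ (subst (k ≤_)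
          (sym (trans (cong toℕ eq) (Fin.toℕ-↑ʳ k i′))) (ℕ.m≤m+n k _)))

  toʳ : ∀ j → ∃ λ j′ → π ⟨$⟩ʳ (k ↑ʳ j) ≡ k ↑ʳ j′
  toʳ j with side k (π ⟨$⟩ʳ (k ↑ʳ j))
  ... | inj₁ (i′ , eq) = contradiction (high j) (ℕ.<⇒≱ (subst (_< k)
          (sym (trans (cong toℕ eq) (Fin.toℕ-↑ˡ i′ r))) (Fin.toℕ<n i′)))
  ... | inj₂ l = l

  ↑ˡ≢↑ʳ : ∀ {i : Fin k} {j : Fin r} → i ↑ˡ r ≢ k ↑ʳ j
  ↑ˡ≢↑ʳ {i} {j} eq with () ← trans (sym (Fin.splitAt-↑ˡ k i r))
                              (trans (cong (splitAt k) eq) (Fin.splitAt-↑ʳ k r j))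

  fromˡ : ∀ i → ∃ λ i′ → π ⟨$⟩ˡ (i ↑ˡ r) ≡ i′ ↑ˡ r
  fromˡ i with side k (π ⟨$⟩ˡ (i ↑ˡ r))
  ... | inj₁ l = l
  ... | inj₂ (j , eq) = contradiction
          (trans (trans (sym (inverseʳ π)) (cong (π ⟨$⟩ʳ_) eq)) (proj₂ (toʳ j))) ↑ˡ≢↑ʳ

  fromʳ : ∀ j → ∃ λ j′ → π ⟨$⟩ˡ (k ↑ʳ j) ≡ k ↑ʳ j′
  fromʳ j with side k (π ⟨$⟩ˡ (k ↑ʳ j))
  ... | inj₁ (i , eq) = contradiction
          (sym (trans (trans (sym (inverseʳ π)) (cong (π ⟨$⟩ʳ_) eq)) (proj₂ (toˡ i)))) ↑ˡ≢↑ʳ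
  ... | inj₂ l = l

  σ = restrict (_↑ˡ r) (Fin.↑ˡ-injective r _ _) π toˡ fromˡ
  τ = restrict (k ↑ʳ_) (Fin.↑ʳ-injective k _ _) π toʳ fromʳ

  π≈σ⊕τ : ∀ x → π ⟨$⟩ʳ x ≡ proj₁ σ ⊕ proj₁ τ ⟨$⟩ʳ x
  π≈σ⊕τ x with side k x
  ... | inj₁ (i , refl) = trans (proj₂ σ i) (sym (⊕-↑ˡ (proj₁ σ) (proj₁ τ) i))
  ... | inj₂ (i , refl) = trans (proj₂ τ i) (sym (⊕-↑ʳ (proj₁ σ) (proj₁ τ) i))

last-max⇒decomposable : ∀ k → (π : Permutation′ (k ℕ.+ 1)) → 0 < k →
                        letter π (k ↑ʳ zero) ≡ k ℕ.+ 1 → Decomposable π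
last-max⇒decomposable k π 0<k max = ascending⇒decomposable k 1 0<k (s≤s z≤n) π asc
  where
  asc : ∀ i j → letter π (i ↑ˡ 1) < letter π (k ↑ʳ j)
  asc i zero = ℕ.≤∧≢⇒< (subst (letter π (i ↑ˡ 1) ≤_) (sym max) (letter≤ π (i ↑ˡ 1))) λ eq →
    ℕ.<⇒≢ (Fin.toℕ<n i) (trans (sym (Fin.toℕ-↑ˡ i 1)) (trans
      (cong toℕ (⟨$⟩ʳ-injective π (Fin.toℕ-injective (ℕ.suc-injective eq))))
      (trans (Fin.toℕ-↑ʳ k zero) (ℕ.+-identityʳ k))))

prefix⇒decomposable : (π : Permutation′ n) → ∀ xs {ys vs} → 0 < length xs → length xs < n →
  Below xs ys → OrderIso (xs ++ ys) (pick (letter π) ⊤ ++ vs) → Decomposable π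
prefix⇒decomposable {n} π xs {ys} {vs} 0<k k<n xs<ys iso =
  go (n ∸ length xs) (ℕ.m<n⇒0<n∸m k<n) (ℕ.m+[n∸m]≡n (ℕ.<⇒≤ k<n)) π iso
  where
  go : ∀ r → 0 < r → ∀ {n} → length xs ℕ.+ r ≡ n → (π : Permutation′ n) →
       OrderIso (xs ++ ys) (pick (letter π) ⊤ ++ vs) → Decomposable π
  go r 0<r refl π iso = ascending⇒decomposable (length xs) r 0<k 0<r π λ i j →
      orderIso-below xs heads (sym (trans (length-pick _ (⊤ {length xs})) (∣⊤∣≡n (length xs)))) xs<ys
        (subst (OrderIso (xs ++ ys)) split iso)
        (∈-pick-⊤ (letter π ∘ (_↑ˡ r)) i) (∈-++⁺ˡ (∈-pick-⊤ (letter π ∘ (length xs ↑ʳ_)) j))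
    where
    heads = pick (letter π ∘ (_↑ˡ r)) ⊤
    split : pick (letter π) ⊤ ++ vs ≡ heads ++ (pick (letter π ∘ (length xs ↑ʳ_)) ⊤ ++ vs)
    split = trans (cong (_++ vs) (trans (cong (pick (letter π)) (⊤-++ (length xs)))
                                        (pick-++ (letter π) (⊤ {length xs}) ⊤)))
                  (List.++-assoc heads (pick (letter π ∘ (length xs ↑ʳ_)) ⊤) vs)

-- Embeddings of powers

∈-++ˡ⁺ : ∀ {a : Subset j} {b : Subset k} {i} → i ∈ a → i ↑ˡ k ∈ a Vec.++ b
∈-++ˡ⁺ Vec.here      = Vec.here
∈-++ˡ⁺ (Vec.there p) = Vec.there (∈-++ˡ⁺ p)

∈-++ʳ⁺ : ∀ (a : Subset j) {b : Subset k} {i} → i ∈ b → j ↑ʳ i ∈ a Vec.++ b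
∈-++ʳ⁺ []      p = p
∈-++ʳ⁺ (_ ∷ a) p = Vec.there (∈-++ʳ⁺ a p)

∈-++ˡ⁻ : ∀ (a : Subset j) {b : Subset k} {i} → i ↑ˡ k ∈ a Vec.++ b → i ∈ a
∈-++ˡ⁻ (_ ∷ a) {i = zero}  Vec.here      = Vec.here
∈-++ˡ⁻ (_ ∷ a) {i = suc i} (Vec.there p) = Vec.there (∈-++ˡ⁻ a p)

∈-++ʳ⁻ : ∀ (a : Subset j) {b : Subset k} {i} → j ↑ʳ i ∈ a Vec.++ b → i ∈ b
∈-++ʳ⁻ []      p             = p
∈-++ʳ⁻ (_ ∷ a) (Vec.there p) = ∈-++ʳ⁻ a p

∣p∣≡0⇒p≡⊥ : ∀ (p : Subset n) → ∣ p ∣ ≡ 0 → p ≡ ⊥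
∣p∣≡0⇒p≡⊥ []            _ = refl
∣p∣≡0⇒p≡⊥ (outside ∷ p) e = cong (outside ∷_) (∣p∣≡0⇒p≡⊥ p e)

lookup-embed : (π : Permutation′ n) (p : Subset n) → ∀ i → Vec.lookup (embed π p) i ≢ 0 ⇔ i ∈ p
lookup-embed π p i rewrite Vec.lookup∘tabulate (λ i → if does (i ∈? p) then letter π i else 0) i
  with i ∈? p
... | yes i∈p = mk⇔ (λ _ → i∈p) (λ _ ())
... | no  i∉p = mk⇔ (λ ≢0 → contradiction refl ≢0) (λ i∈p → contradiction i∈p i∉p)

∈-Z⇔ : (η : Vec ℕ n) → ∀ i → i ∈ Z η ⇔ Vec.lookup η i ≡ 0
∈-Z⇔ η i = mk⇔
  (λ i∈ → to (trans (sym (Vec.lookup-map i (λ x → does (x ℕ.≟ 0)) η)) (Vec.[]=⇒lookup i∈)))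
  (λ eq → Vec.lookup⇒[]= i (Z η)
     (trans (Vec.lookup-map i (λ x → does (x ℕ.≟ 0)) η) (dec-true (Vec.lookup η i ℕ.≟ 0) eq)))
  where
  to : ∀ {x} → does (x ℕ.≟ 0) ≡ true → x ≡ 0
  to {zero} _ = refl

Disjoint : Subset n → Subset n → Set
Disjoint T p = ∀ {i} → i ∈ T → i ∉ p

⊆-Z⇔ : (π : Permutation′ n) (T p : Subset n) → T ⊆ Z (embed π p) ⇔ Disjoint T p
⊆-Z⇔ π T p = mk⇔
  (λ T⊆ {i} i∈T i∈p → Equivalence.from (lookup-embed π p i) i∈p
                        (Equivalence.to (∈-Z⇔ (embed π p) i) (T⊆ i∈T)))
  (λ disj {i} i∈T → Equivalence.from (∈-Z⇔ (embed π p) i)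
     (decidable-stable (Vec.lookup (embed π p) i ℕ.≟ 0) (λ ≢0 → disj i∈T (Equivalence.to (lookup-embed π p i) ≢0))))

∈-subsets : (p : Subset n) → p ∈ˡ subsets n
∈-subsets []            = here refl
∈-subsets {suc n} (inside  ∷ p) = ∈-++⁺ˡ (∈-map⁺ (inside ∷_) (∈-subsets p))
∈-subsets {suc n} (outside ∷ p) =
  ∈-++⁺ʳ (List.map (inside ∷_) (subsets n)) (∈-map⁺ (outside ∷_) (∈-subsets p))

∈-Ê⁺ : (σ : Permutation′ k) (π : Permutation′ n) (p : Subset n) →
       IsOccurrence σ π p → Rightmost π (embed π p) → embed π p ∈ˡ Ê σ π
∈-Ê⁺ σ π p occ rm = ∈-filter⁺ (rightmost? π)
  (∈-map⁺ (embed π) (∈-filter⁺ (isOccurrence? σ π) (∈-subsets p) occ)) rm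

∈-Ê⁻ : (σ : Permutation′ k) (π : Permutation′ n) → ∀ {η} → η ∈ˡ Ê σ π →
       ∃ λ p → IsOccurrence σ π p × η ≡ embed π p
∈-Ê⁻ {n = n} σ π η∈
  with p , p∈ , eq ← ∈-map⁻ (embed π) (proj₁ (∈-filter⁻ (rightmost? π) η∈)) =
  p , proj₂ (∈-filter⁻ (isOccurrence? σ π) {xs = subsets n} p∈) , eq

isOccurrence⇔ : (σ : Permutation′ k) (π : Permutation′ n) (p : Subset n) →
                IsOccurrence σ π p ⇔ OrderIso (pick (letter π) p) (pick (letter σ) ⊤)
isOccurrence⇔ σ π p rewrite lettersAt≡pick π p | word≡pick σ =
  mk⇔ sameOrder⇒orderIso orderIso⇒sameOrder

run-closed⇒rightmost : (π : Permutation′ n) (p : Subset n) →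
  (∀ x y → toℕ y ≡ suc (toℕ x) → letter π y ≡ suc (letter π x) ⊎ letter π x ≡ suc (letter π y) →
           x ∈ p → y ∈ p) →
  Rightmost π (embed π p)
run-closed⇒rightmost {n} π p closed i j (_ , run , _) x y i≤x x<y y≤j ≢0 =
  Equivalence.from (lookup-embed π p y)
    (walk (toℕ y ∸ toℕ x) x i≤x (sym (ℕ.m+[n∸m]≡n (ℕ.<⇒≤ x<y))) (Equivalence.to (lookup-embed π p x) ≢0))
  where
  adjacent : ∀ x x′ → i Fin.≤ x → x′ Fin.≤ j → toℕ x′ ≡ suc (toℕ x) →
             letter π x′ ≡ suc (letter π x) ⊎ letter π x ≡ suc (letter π x′)
  adjacent x x′ i≤x x′≤j eq = Sum.map (λ inc → inc x x′ i≤x x′≤j eq) (λ dec → dec x x′ i≤x x′≤j eq) run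

  walk : ∀ d x → i Fin.≤ x → toℕ y ≡ toℕ x ℕ.+ d → x ∈ p → y ∈ p
  walk zero    x i≤x eq x∈p =
    subst (_∈ p) (Fin.toℕ-injective (trans (sym (ℕ.+-identityʳ _)) (sym eq))) x∈p
  walk (suc d) x i≤x eq x∈p = walk d x⁺
    (ℕ.≤-trans i≤x (ℕ.≤-trans (ℕ.n≤1+n _) (ℕ.≤-reflexive (sym x⁺≡))))
    (trans eq′ (cong (ℕ._+ d) (sym x⁺≡)))
    (closed x x⁺ x⁺≡ (adjacent x x⁺ i≤x (ℕ.≤-trans (ℕ.≤-reflexive x⁺≡) (ℕ.≤-trans x<y′ y≤j)) x⁺≡) x∈p)
    where
    eq′ : toℕ y ≡ suc (toℕ x) ℕ.+ d
    eq′ = trans eq (ℕ.+-suc (toℕ x) d)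
    x<y′ : suc (toℕ x) ≤ toℕ y
    x<y′ = ℕ.≤-trans (ℕ.m≤m+n _ d) (ℕ.≤-reflexive (sym eq′))
    x⁺ : Fin n
    x⁺ = fromℕ< (ℕ.≤-<-trans x<y′ (Fin.toℕ<n y))
    x⁺≡ : toℕ x⁺ ≡ suc (toℕ x)
    x⁺≡ = Fin.toℕ-fromℕ< _

data BlockUnion (ℓ : ℕ) : ∀ n → ℕ → Subset (n ℕ.* ℓ) → Set where
  []   : BlockUnion ℓ 0 0 []
  take : ∀ {p} → BlockUnion ℓ n m p → BlockUnion ℓ (suc n) (suc m) (⊤ {ℓ} Vec.++ p)
  skip : ∀ {p} → BlockUnion ℓ n m p → BlockUnion ℓ (suc n) m (⊥ {ℓ} Vec.++ p)

module _ {ℓ : ℕ} (ƛ : Permutation′ ℓ) where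

  Occurs : ∀ n m → Subset (n ℕ.* ℓ) → Set
  Occurs n m p = OrderIso (pick (letter (ƛ ^⊕ n)) p) (pick (letter (ƛ ^⊕ m)) ⊤)

  pick-power : ∀ m → pick (letter (ƛ ^⊕ suc m)) ⊤ ≡
                     pick (letter ƛ) ⊤ ++ List.map (ℓ ℕ.+_) (pick (letter (ƛ ^⊕ m)) ⊤)
  pick-power m = trans (cong (pick (letter (ƛ ^⊕ suc m))) (⊤-++ ℓ)) (pick-⊕ ƛ (ƛ ^⊕ m) ⊤ ⊤)

  blockUnion⇒occurs : ∀ {p} → BlockUnion ℓ n m p → Occurs n m p
  blockUnion⇒occurs []                        = refl , λ ()
  blockUnion⇒occurs {suc n} {suc m} (take {p = p} u) =
    subst₂ OrderIso (sym (pick-⊕ ƛ (ƛ ^⊕ n) ⊤ p)) (sym (pick-power m))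
      (orderIso-++⁺ (pick (letter ƛ) ⊤) (pick-below ƛ (ƛ ^⊕ n) ⊤ p) (pick-below ƛ (ƛ ^⊕ m) ⊤ ⊤)
        (orderIso-shift⁺ ℓ ℓ (blockUnion⇒occurs u)))
  blockUnion⇒occurs {suc n} {m} (skip {p = p} u) =
    subst₂ OrderIso (sym (pick-⊥-⊕ ƛ (ƛ ^⊕ n) p)) (List.map-id (pick (letter (ƛ ^⊕ m)) ⊤))
      (orderIso-shift⁺ ℓ 0 (blockUnion⇒occurs u))

  module _ (1<ℓ : 1 < ℓ) (indecomposable : Indecomposable ƛ) where

    occurs⇒blockUnion : ∀ n m p → Occurs n m p → BlockUnion ℓ n m p
    occurs⇒blockUnion zero zero    [] _       = []
    occurs⇒blockUnion zero (suc m) [] (e , _) = contradiction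
      (trans e (trans (length-pick _ (⊤ {suc m ℕ.* ℓ})) (∣⊤∣≡n (suc m ℕ.* ℓ))))
      (ℕ.<⇒≢ (ℕ.<-≤-trans (ℕ.<-trans (s≤s z≤n) 1<ℓ) (ℕ.m≤m+n ℓ (m ℕ.* ℓ))))
    occurs⇒blockUnion (suc n) m p occ with Vec.splitAt ℓ p
    ... | a , q , refl = split (∣ a ∣) refl
      where
      iso : OrderIso (pick (letter ƛ) a ++ List.map (ℓ ℕ.+_) (pick (letter (ƛ ^⊕ n)) q))
                     (pick (letter (ƛ ^⊕ m)) ⊤)
      iso = subst (λ xs → OrderIso xs _) (pick-⊕ ƛ (ƛ ^⊕ n) a q) occ

      proper : ∀ m → OrderIso (pick (letter ƛ) a ++ List.map (ℓ ℕ.+_) (pick (letter (ƛ ^⊕ n)) q))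
                     (pick (letter (ƛ ^⊕ m)) ⊤) → 0 < ∣ a ∣ → BlockUnion ℓ (suc n) m (a Vec.++ q)
      proper zero (e , _) 0<a = contradiction
        (subst (0 <_) (sym (length-pick (letter ƛ) a)) 0<a)
        (ℕ.≤⇒≯ (ℕ.≤-trans (ℕ.m≤m+n _ _)
          (ℕ.≤-reflexive (trans (sym (List.length-++ (pick (letter ƛ) a))) e))))
      proper (suc m) iso 0<a with ∣ a ∣ ℕ.≟ ℓ
      ... | yes eq with refl ← ∣p∣≡n⇒p≡⊤ {p = a} eq =
        take (occurs⇒blockUnion n m q (orderIso-shift⁻ ℓ ℓ
          (orderIso-++⁻ (pick (letter ƛ) ⊤) (subst (OrderIso _) (pick-power m) iso))))
      ... | no ne = contradiction
        (prefix⇒decomposable ƛ (pick (letter ƛ) a)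
          (subst (0 <_) (sym (length-pick (letter ƛ) a)) 0<a)
          (subst (_< ℓ) (sym (length-pick (letter ƛ) a)) (ℕ.≤∧≢⇒< (∣p∣≤n a) ne))
          (pick-below ƛ (ƛ ^⊕ n) a q)
          (subst (OrderIso _) (pick-power m) iso))
        indecomposable

      split : ∀ c → ∣ a ∣ ≡ c → BlockUnion ℓ (suc n) m (a Vec.++ q)
      split zero eq with refl ← ∣p∣≡0⇒p≡⊥ a eq =
        skip (occurs⇒blockUnion n m q (orderIso-shift⁻ ℓ 0
          (subst₂ OrderIso (pick-⊥-⊕ ƛ (ƛ ^⊕ n) q) (sym (List.map-id (pick (letter (ƛ ^⊕ m)) ⊤))) occ)))
      split (suc c) eq = proper m iso (subst (0 <_) (sym eq) (s≤s z≤n))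

    ¬last-max : ∀ i → suc (toℕ i) ≡ ℓ → letter ƛ i ≢ ℓ
    ¬last-max i last max = go (toℕ i) (trans (ℕ.+-comm (toℕ i) 1) last) ƛ 1<ℓ indecomposable i refl max
      where
      go : ∀ k {ℓ} → k ℕ.+ 1 ≡ ℓ → (ƛ : Permutation′ ℓ) → 1 < ℓ → Indecomposable ƛ →
           ∀ i → toℕ i ≡ k → letter ƛ i ≢ ℓ
      go k refl ƛ 1<ℓ ind i i≡k max with refl ← Fin.toℕ-injective {i = i} {j = k ↑ʳ zero}
             (trans i≡k (trans (sym (ℕ.+-identityʳ k)) (sym (Fin.toℕ-↑ʳ k zero)))) =
        ind (last-max⇒decomposable k ƛ (ℕ.≤-pred (subst (1 <_) (ℕ.+-comm k 1) 1<ℓ)) max)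

    -- A run crossing from one copy of ƛ to the next would force ƛ to end with its maximum.
    blockUnion-closed : ∀ {p} → BlockUnion ℓ n m p → ∀ x y → toℕ y ≡ suc (toℕ x) →
      letter (ƛ ^⊕ n) y ≡ suc (letter (ƛ ^⊕ n) x) ⊎ letter (ƛ ^⊕ n) x ≡ suc (letter (ƛ ^⊕ n) y) →
      x ∈ p → y ∈ p
    blockUnion-closed {suc n} {m} {p} u x y next adj x∈ with side ℓ x | side ℓ y
    ... | inj₁ (i , refl) | inj₂ (j , refl) = contradiction (crossing adj) (¬last-max i last)
      where
      open ℕ.≤-Reasoning
      last : suc (toℕ i) ≡ ℓ
      last = ℕ.≤-antisym (Fin.toℕ<n i) (begin
        ℓ                           ≤⟨ ℕ.m≤m+n ℓ (toℕ j) ⟩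
        ℓ ℕ.+ toℕ j                 ≡⟨ Fin.toℕ-↑ʳ ℓ j ⟨
        toℕ (ℓ ↑ʳ j)                ≡⟨ next ⟩
        suc (toℕ (i ↑ˡ (n ℕ.* ℓ)))  ≡⟨ cong suc (Fin.toℕ-↑ˡ i _) ⟩
        suc (toℕ i)                 ∎)

      ℓ<y : ℓ < letter (ƛ ^⊕ suc n) (ℓ ↑ʳ j)
      ℓ<y = begin-strict
        ℓ                                ≤⟨ ℕ.m≤m+n ℓ _ ⟩
        ℓ ℕ.+ toℕ (ƛ ^⊕ n ⟨$⟩ʳ j)        <⟨ ℕ.n<1+n _ ⟩
        suc (ℓ ℕ.+ toℕ (ƛ ^⊕ n ⟨$⟩ʳ j))  ≡⟨ ℕ.+-suc ℓ _ ⟨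
        ℓ ℕ.+ letter (ƛ ^⊕ n) j          ≡⟨ letter-⊕ʳ ƛ (ƛ ^⊕ n) j ⟨
        letter (ƛ ^⊕ suc n) (ℓ ↑ʳ j)     ∎

      x≡ : letter (ƛ ^⊕ suc n) (i ↑ˡ (n ℕ.* ℓ)) ≡ letter ƛ i
      x≡ = letter-⊕ˡ ƛ (ƛ ^⊕ n) i

      crossing : letter (ƛ ^⊕ suc n) (ℓ ↑ʳ j) ≡ suc (letter (ƛ ^⊕ suc n) (i ↑ˡ (n ℕ.* ℓ))) ⊎
                 letter (ƛ ^⊕ suc n) (i ↑ˡ (n ℕ.* ℓ)) ≡ suc (letter (ƛ ^⊕ suc n) (ℓ ↑ʳ j)) →
                 letter ƛ i ≡ ℓ
      crossing (inj₁ inc) = ℕ.≤-antisym (letter≤ ƛ i)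
        (ℕ.≤-pred (subst (ℓ <_) (trans inc (cong suc x≡)) ℓ<y))
      crossing (inj₂ dec) = contradiction (letter≤ ƛ i)
        (ℕ.<⇒≱ (subst (ℓ <_) (trans (sym dec) x≡) (ℕ.m<n⇒m<1+n ℓ<y)))
    ... | inj₂ (i , refl) | inj₁ (j , refl) = contradiction (ℕ.≤-reflexive (sym next)) (ℕ.<⇒≱ (begin-strict
        toℕ (j ↑ˡ (n ℕ.* ℓ))  ≡⟨ Fin.toℕ-↑ˡ j _ ⟩
        toℕ j                 <⟨ Fin.toℕ<n j ⟩
        ℓ                     ≤⟨ ℕ.m≤m+n ℓ _ ⟩
        ℓ ℕ.+ toℕ i           ≡⟨ Fin.toℕ-↑ʳ ℓ i ⟨
        toℕ (ℓ ↑ʳ i)          <⟨ ℕ.n<1+n _ ⟩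
        suc (toℕ (ℓ ↑ʳ i))    ∎))
      where open ℕ.≤-Reasoning
    blockUnion-closed (take u) x y next adj x∈ | inj₁ _ | inj₁ (j , refl) = ∈-++ˡ⁺ ∈⊤
    blockUnion-closed (skip u) x y next adj x∈ | inj₁ (i , refl) | inj₁ _ =
      contradiction (∈-++ˡ⁻ ⊥ x∈) ∉⊥
    blockUnion-closed {suc n} u x y next adj x∈ | inj₂ (i , refl) | inj₂ (j , refl) = later u x∈
      where
      next′ : toℕ j ≡ suc (toℕ i)
      next′ = ℕ.+-cancelˡ-≡ ℓ _ _ (trans (sym (Fin.toℕ-↑ʳ ℓ j)) (trans next
        (trans (cong suc (Fin.toℕ-↑ʳ ℓ i)) (sym (ℕ.+-suc ℓ (toℕ i))))))

      unshift : ∀ {i j} → letter (ƛ ^⊕ suc n) (ℓ ↑ʳ j) ≡ suc (letter (ƛ ^⊕ suc n) (ℓ ↑ʳ i)) →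
                letter (ƛ ^⊕ n) j ≡ suc (letter (ƛ ^⊕ n) i)
      unshift {i} {j} eq = ℕ.+-cancelˡ-≡ ℓ _ _ (trans (sym (letter-⊕ʳ ƛ (ƛ ^⊕ n) j)) (trans eq
        (trans (cong suc (letter-⊕ʳ ƛ (ƛ ^⊕ n) i)) (sym (ℕ.+-suc ℓ _)))))

      later : ∀ {m p} → BlockUnion ℓ (suc n) m p → ℓ ↑ʳ i ∈ p → ℓ ↑ʳ j ∈ p
      later (take u) i∈ = ∈-++ʳ⁺ ⊤ (blockUnion-closed u i j next′ (Sum.map unshift unshift adj) (∈-++ʳ⁻ ⊤ i∈))
      later (skip u) i∈ = ∈-++ʳ⁺ ⊥ (blockUnion-closed u i j next′ (Sum.map unshift unshift adj) (∈-++ʳ⁻ ⊥ i∈))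

    ∈-Ê⇔ : ∀ n m η → η ∈ˡ Ê (ƛ ^⊕ m) (ƛ ^⊕ n) ⇔ (∃ λ p → BlockUnion ℓ n m p × η ≡ embed (ƛ ^⊕ n) p)
    ∈-Ê⇔ n m η = mk⇔ to from
      where
      to : η ∈ˡ Ê (ƛ ^⊕ m) (ƛ ^⊕ n) → ∃ λ p → BlockUnion ℓ n m p × η ≡ embed (ƛ ^⊕ n) p
      to η∈ with p , occ , eq ← ∈-Ê⁻ (ƛ ^⊕ m) (ƛ ^⊕ n) η∈ =
        p , occurs⇒blockUnion n m p (Equivalence.to (isOccurrence⇔ (ƛ ^⊕ m) (ƛ ^⊕ n) p) occ) , eq

      from : (∃ λ p → BlockUnion ℓ n m p × η ≡ embed (ƛ ^⊕ n) p) → η ∈ˡ Ê (ƛ ^⊕ m) (ƛ ^⊕ n)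
      from (p , u , refl) = ∈-Ê⁺ (ƛ ^⊕ m) (ƛ ^⊕ n) p
        (Equivalence.from (isOccurrence⇔ (ƛ ^⊕ m) (ƛ ^⊕ n) p) (blockUnion⇒occurs u))
        (run-closed⇒rightmost (ƛ ^⊕ n) p (blockUnion-closed u))

-- Copies avoided by a set of positions

module _ (ℓ : ℕ) where

  freeBlocks : ∀ n → Subset (n ℕ.* ℓ) → ℕ
  freeBlocks zero    T = 0
  freeBlocks (suc n) T =
    if does (nonempty? (Vec.take ℓ T)) then freeBlocks n (Vec.drop ℓ T)
                                       else suc (freeBlocks n (Vec.drop ℓ T))

  freeBlocks-++ : ∀ n (a : Subset ℓ) b → freeBlocks (suc n) (a Vec.++ b) ≡
                  (if does (nonempty? a) then freeBlocks n b else suc (freeBlocks n b))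
  freeBlocks-++ n a b with Vec.++-injective (Vec.take ℓ (a Vec.++ b)) a (Vec.take++drop≡id ℓ (a Vec.++ b))
  ... | p , q = cong₂ (λ a b → if does (nonempty? a) then freeBlocks n b else suc (freeBlocks n b)) p q

  free⇒blockUnion : ∀ n m T → m ≤ freeBlocks n T → ∃ λ p → BlockUnion ℓ n m p × Disjoint T p
  free⇒blockUnion zero    zero T _ = [] , [] , λ { {()} }
  free⇒blockUnion (suc n) m T m≤ with Vec.splitAt ℓ T
  ... | a , b , refl with nonempty? a | m≤
  ...   | yes _ | m≤b = let p , u , disj = free⇒blockUnion n m b m≤b in
          ⊥ {ℓ} Vec.++ p , skip u , disjoint-⊥ disj
    where
    disjoint-⊥ : ∀ {p} → Disjoint b p → Disjoint (a Vec.++ b) (⊥ Vec.++ p)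
    disjoint-⊥ disj {i} i∈T i∈p with side ℓ i
    ... | inj₁ (i , refl) = ∉⊥ (∈-++ˡ⁻ ⊥ i∈p)
    ... | inj₂ (i , refl) = disj (∈-++ʳ⁻ a i∈T) (∈-++ʳ⁻ ⊥ i∈p)
  ...   | no a-empty | m≤1+b = choose m m≤1+b
    where
    disjoint-empty : ∀ c {p} → Disjoint b p → Disjoint (a Vec.++ b) (c Vec.++ p)
    disjoint-empty c disj {i} i∈T i∈p with side ℓ i
    ... | inj₁ (i , refl) = a-empty (i , ∈-++ˡ⁻ a i∈T)
    ... | inj₂ (i , refl) = disj (∈-++ʳ⁻ a i∈T) (∈-++ʳ⁻ c i∈p)

    choose : ∀ m → m ≤ suc (freeBlocks n b) → ∃ λ p → BlockUnion ℓ (suc n) m p × Disjoint (a Vec.++ b) p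
    choose zero    _ = let p , u , disj = free⇒blockUnion n zero b z≤n in
      ⊥ {ℓ} Vec.++ p , skip u , disjoint-empty ⊥ disj
    choose (suc m) (s≤s m≤) = let p , u , disj = free⇒blockUnion n m b m≤ in
      ⊤ {ℓ} Vec.++ p , take u , disjoint-empty ⊤ disj

  blockUnion⇒free : ∀ {p} → BlockUnion ℓ n m p → ∀ T → Disjoint T p → m ≤ freeBlocks n T
  blockUnion⇒free []               T disj = z≤n
  blockUnion⇒free {suc n} (take u) T disj with Vec.splitAt ℓ T
  ... | a , b , refl with nonempty? a
  ...   | yes (i , i∈a) = contradiction (∈-++ˡ⁺ ∈⊤) (disj (∈-++ˡ⁺ i∈a))
  ...   | no  _ = s≤s (blockUnion⇒free u b λ i∈b i∈p → disj (∈-++ʳ⁺ a i∈b) (∈-++ʳ⁺ (⊤ {ℓ}) i∈p))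
  blockUnion⇒free {suc n} (skip u) T disj with Vec.splitAt ℓ T
  ... | a , b , refl with nonempty? a
  ...   | yes _ = blockUnion⇒free u b λ i∈b i∈p → disj (∈-++ʳ⁺ a i∈b) (∈-++ʳ⁺ (⊥ {ℓ}) i∈p)
  ...   | no  _ = ℕ.m≤n⇒m≤1+n (blockUnion⇒free u b λ i∈b i∈p → disj (∈-++ʳ⁺ a i∈b) (∈-++ʳ⁺ (⊥ {ℓ}) i∈p))

few : ℕ → ℕ → ℤ
few m x = 1ℤ - 𝟙 (m ℕ.≤? x)

few-suc : ∀ m x → few (suc m) (suc x) ≡ few m x
few-suc m x = cong (λ i → 1ℤ - i) (𝟙-⇔ (mk⇔ ℕ.≤-pred s≤s) (suc m ℕ.≤? suc x) (m ℕ.≤? x))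

module _ (ℓ : ℕ) where

  fewFree : ℕ → ℕ → ℤ
  fewFree n m = alt (n ℕ.* suc ℓ) (λ T → few m (freeBlocks (suc ℓ) n T))

  fewFree-0 : ∀ n → fewFree n 0 ≡ 0ℤ
  fewFree-0 n = trans (alt-cong (n ℕ.* suc ℓ) (λ T → refl)) (alt-0 (n ℕ.* suc ℓ))

  fewFree-suc : ∀ n m → fewFree (suc n) (suc m) ≡ fewFree n m - fewFree n (suc m)
  fewFree-suc n m = begin
    fewFree (suc n) (suc m)
      ≡⟨ alt-++ (suc ℓ) (λ T → few (suc m) (freeBlocks (suc ℓ) (suc n) T)) ⟩
    alt (suc ℓ) (λ a → alt L (λ b → few (suc m) (freeBlocks (suc ℓ) (suc n) (a Vec.++ b))))
      ≡⟨ alt-cong (suc ℓ) block ⟩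
    alt (suc ℓ) (λ a → if does (nonempty? a) then fewFree n (suc m) else fewFree n m)
      ≡⟨ alt-nonempty ℓ (fewFree n m) (fewFree n (suc m)) ⟩
    fewFree n m - fewFree n (suc m) ∎
    where
    open ≡-Reasoning
    L = n ℕ.* suc ℓ

    block : ∀ a → alt L (λ b → few (suc m) (freeBlocks (suc ℓ) (suc n) (a Vec.++ b))) ≡
                  (if does (nonempty? a) then fewFree n (suc m) else fewFree n m)
    block a = trans (alt-cong L λ b → cong (few (suc m)) (freeBlocks-++ (suc ℓ) n a b))
                    (branch (does (nonempty? a)))
      where
      branch : ∀ d → alt L (λ b → few (suc m) (if d then freeBlocks (suc ℓ) n b
                                                    else suc (freeBlocks (suc ℓ) n b))) ≡
                     (if d then fewFree n (suc m) else fewFree n m)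
      branch true  = refl
      branch false = alt-cong L (λ b → few-suc m (freeBlocks (suc ℓ) n b))

  fewFree-binomial : ∀ n m → fewFree (suc n) (suc m) ≡ -1ℤ ^ (suc n ℕ.+ m) * + (n C m)
  fewFree-binomial zero zero    = fewFree-suc 0 0
  fewFree-binomial zero (suc m) = trans (fewFree-suc 0 (suc m)) (sym (ℤ.*-zeroʳ (-1ℤ ^ (suc (suc m)))))
  fewFree-binomial (suc n) zero = begin
    fewFree (suc (suc n)) 1                    ≡⟨ fewFree-suc (suc n) 0 ⟩
    fewFree (suc n) 0 - fewFree (suc n) 1      ≡⟨ cong₂ _-_ (fewFree-0 (suc n)) (fewFree-binomial n 0) ⟩
    0ℤ - -1ℤ ^ (suc n ℕ.+ 0) * 1ℤ              ≡⟨ flip-sign (-1ℤ ^ (suc n ℕ.+ 0)) ⟩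
    -1ℤ ^ (suc (suc n) ℕ.+ 0) * 1ℤ             ∎
    where
    open ≡-Reasoning
    flip-sign : ∀ s → 0ℤ - s * 1ℤ ≡ (-1ℤ * s) * 1ℤ
    flip-sign = solve-∀
  fewFree-binomial (suc n) (suc m) = begin
    fewFree (suc (suc n)) (suc (suc m))                    ≡⟨ fewFree-suc (suc n) (suc m) ⟩
    fewFree (suc n) (suc m) - fewFree (suc n) (suc (suc m))
      ≡⟨ cong₂ _-_ (fewFree-binomial n m) (fewFree-binomial n (suc m)) ⟩
    s * + (n C m) - -1ℤ ^ (suc n ℕ.+ suc m) * + (n C suc m)
      ≡⟨ cong (λ e → s * + (n C m) - -1ℤ ^ e * + (n C suc m)) (ℕ.+-suc (suc n) m) ⟩
    s * + (n C m) - (-1ℤ * s) * + (n C suc m)              ≡⟨ factor s (+ (n C m)) (+ (n C suc m)) ⟩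
    (-1ℤ * (-1ℤ * s)) * (+ (n C m) + + (n C suc m))
      ≡⟨ cong₂ _*_ (cong (-1ℤ ^_) {suc (suc (suc n ℕ.+ m))} (cong suc (sym (ℕ.+-suc (suc n) m))))
                   (trans (sym (ℤ.pos-+ (n C m) (n C suc m))) (cong +_ (nCk+nC[k+1]≡[n+1]C[k+1] n m))) ⟩
    -1ℤ ^ (suc (suc n) ℕ.+ suc m) * + (suc n C suc m)      ∎
    where
    open ≡-Reasoning
    s = -1ℤ ^ (suc n ℕ.+ m)
    factor : ∀ s a b → s * a - (-1ℤ * s) * b ≡ (-1ℤ * (-1ℤ * s)) * (a + b)
    factor = solve-∀

-- For d = 0 the integer exponent on the right is -1, of which -1^_ takes the absolute value.
sign-parity : ∀ m d → -1ℤ ^ (suc (m ℕ.+ d) ℕ.+ m) ≡ -1^ (+ suc (m ℕ.+ d) - + suc m - 1ℤ)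
sign-parity m d = begin
  -1ℤ ^ (suc (m ℕ.+ d) ℕ.+ m)                      ≡⟨ cong (λ e → -1ℤ ^ suc e) exponents ⟩
  -1ℤ * -1ℤ ^ (d ℕ.+ (m ℕ.+ m))                    ≡⟨ cong (-1ℤ *_) (even-shift d m) ⟩
  -1ℤ ^ suc d                                      ≡⟨ reduce d ⟩
  -1^ (+ d - 1ℤ)                                   ≡⟨ cong (λ i → -1^ (i - 1ℤ)) difference ⟨
  -1^ (+ suc (m ℕ.+ d) - + suc m - 1ℤ)             ∎
  where
  open ≡-Reasoning
  exponents : (m ℕ.+ d) ℕ.+ m ≡ d ℕ.+ (m ℕ.+ m)
  exponents = trans (cong (ℕ._+ m) (ℕ.+-comm m d)) (ℕ.+-assoc d m m)

  square : ∀ s → -1ℤ * (-1ℤ * s) ≡ s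
  square = solve-∀

  even-shift : ∀ d m → -1ℤ ^ (d ℕ.+ (m ℕ.+ m)) ≡ -1ℤ ^ d
  even-shift d zero    = cong (-1ℤ ^_) (ℕ.+-identityʳ d)
  even-shift d (suc m) = begin
    -1ℤ ^ (d ℕ.+ (suc m ℕ.+ suc m))     ≡⟨ cong (-1ℤ ^_) (trans (ℕ.+-suc d (m ℕ.+ suc m))
                                             (cong suc (trans (cong (d ℕ.+_) (ℕ.+-suc m m)) (ℕ.+-suc d (m ℕ.+ m))))) ⟩
    -1ℤ * (-1ℤ * -1ℤ ^ (d ℕ.+ (m ℕ.+ m))) ≡⟨ square (-1ℤ ^ (d ℕ.+ (m ℕ.+ m))) ⟩
    -1ℤ ^ (d ℕ.+ (m ℕ.+ m))             ≡⟨ even-shift d m ⟩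
    -1ℤ ^ d                             ∎

  reduce : ∀ d → -1ℤ ^ suc d ≡ -1^ (+ d - 1ℤ)
  reduce zero    = refl
  reduce (suc d) = square (-1ℤ ^ d)

  cancel : ∀ a b → (a + b) - a ≡ b
  cancel = solve-∀

  difference : + suc (m ℕ.+ d) - + suc m ≡ + d
  difference = trans (cong (_- + suc m) (ℤ.pos-+ (suc m) d)) (cancel (+ suc m) (+ d))

missed≡few : ∀ ℓ n m (π : Permutation′ (n ℕ.* ℓ)) L →
  (∀ η → η ∈ˡ L ⇔ (∃ λ p → BlockUnion ℓ n m p × η ≡ embed π p)) →
  ∀ T → missed Z L T ≡ few m (freeBlocks ℓ n T)
missed≡few ℓ n m π L L⇔ T = go (m ℕ.≤? freeBlocks ℓ n T)
  where
  few≡ : ∀ {i} → 𝟙 (m ℕ.≤? freeBlocks ℓ n T) ≡ i → few m (freeBlocks ℓ n T) ≡ 1ℤ - i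
  few≡ = cong (λ i → 1ℤ - i)

  avoids : ∀ {η} → (∃ λ p → BlockUnion ℓ n m p × η ≡ embed π p) → T ⊆ Z η → m ≤ freeBlocks ℓ n T
  avoids (p , u , refl) T⊆ = blockUnion⇒free ℓ u T (Equivalence.to (⊆-Z⇔ π T p) T⊆)

  go : Dec (m ≤ freeBlocks ℓ n T) → missed Z L T ≡ few m (freeBlocks ℓ n T)
  go (yes m≤) = let p , u , disj = free⇒blockUnion ℓ n m T m≤ in trans
    (missed≡0 Z L (Equivalence.from (L⇔ (embed π p)) (p , u , refl)) (Equivalence.from (⊆-Z⇔ π T p) disj))
    (sym (few≡ (𝟙-yes (m ℕ.≤? freeBlocks ℓ n T) m≤)))
  go (no m≰) = trans
    (missed≡1 Z L λ {η} η∈ T⊆ → m≰ (avoids (Equivalence.to (L⇔ η) η∈) T⊆))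
    (sym (few≡ (𝟙-no (m ℕ.≤? freeBlocks ℓ n T) m≰)))

EZ-power : ∀ ℓ (ƛ : Permutation′ (suc ℓ)) → 1 < suc ℓ → Indecomposable ƛ → ∀ m n →
           EZ (ƛ ^⊕ m) (ƛ ^⊕ suc n) ≡ fewFree ℓ (suc n) m
EZ-power ℓ ƛ 1<ℓ ind m n = trans (EZ-alt (ƛ ^⊕ m) (ƛ ^⊕ suc n) (s≤s z≤n))
  (alt-cong (suc n ℕ.* suc ℓ)
    (missed≡few (suc ℓ) (suc n) m (ƛ ^⊕ suc n) (Ê (ƛ ^⊕ m) (ƛ ^⊕ suc n)) (∈-Ê⇔ ƛ 1<ℓ ind (suc n) m)))

proposition32 : (ℓ : ℕ) (ƛ : Permutation′ ℓ) → 1 < ℓ → Indecomposable ƛ →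
    (m n : ℕ) → 1 ≤ m → m ≤ n →
    EZ (ƛ ^⊕ m) (ƛ ^⊕ n) ≡ -1^ (+ n - + m - 1ℤ) * + ((n ∸ 1) C (m ∸ 1))
proposition32 (suc ℓ) ƛ 1<ℓ ind (suc m) (suc n) _ (s≤s m≤n) = begin
  EZ (ƛ ^⊕ suc m) (ƛ ^⊕ suc n)              ≡⟨ EZ-power ℓ ƛ 1<ℓ ind (suc m) n ⟩
  fewFree ℓ (suc n) (suc m)                 ≡⟨ fewFree-binomial ℓ n m ⟩
  -1ℤ ^ (suc n ℕ.+ m) * + (n C m)           ≡⟨ cong (_* + (n C m)) (sign m≤n) ⟩
  -1^ (+ suc n - + suc m - 1ℤ) * + (n C m)  ∎
  where
  open ≡-Reasoning
  sign : ∀ {m n} → m ≤ n → -1ℤ ^ (suc n ℕ.+ m) ≡ -1^ (+ suc n - + suc m - 1ℤ)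
  sign {m} m≤n with d , refl ← ℕ.m≤n⇒∃[o]m+o≡n m≤n = sign-parity m d
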